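{- Let $G$ be a finite abstract simplicial complex with connection matrix $L$, and let $g=L^{ -1}$ (which exists and has integer entries). Then $\sum_{x,y\in G} g(x,y)=\chi(G)$, where $\chi(G)=\sum_{x\in G}\omega(x)$.
   Context: A finite abstract simplicial complex $G$ is a finite set of non-empty finite sets closed under taking non-empty subsets; its elements are called simplices. For $x\in G$ let $\dim(x)=|x|-1$ and $\omega(x)=(-1)^{\dim(x)}$. The connection matrix $L$ of $G$ is indexed by the simplices with $L(x,y)=1$ if $x\cap y\neq\emptyset$ and $L(x,y)=0$ otherwise. $\chi(G)=\sum_{x\in G}\omega(x)$ is the Euler characteristic. -}

module Defs where

open import Algebra.Properties.Semiring.Sum using (sum-syntax)
open import Data.Bool using (if_then_else_)
open import Data.Fin using (Fin; _≟_)
open import Data.Fin.Subset using (Subset; Nonempty; _⊆_; _∩_; ∣_∣)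
open import Data.Fin.Subset.Properties using (nonempty?)
open import Data.Integer using (ℤ; 0ℤ; 1ℤ; -1ℤ; _*_; _^_)
open import Data.Integer.Properties using (+-*-semiring)
open import Data.List using (List; length; lookup)
open import Data.List.Membership.Propositional using (_∈_)
open import Data.List.Relation.Unary.All using (All)
open import Data.List.Relation.Unary.Unique.Propositional using (Unique)
open import Data.Nat using (ℕ; _∸_)
open import Data.Product using (_×_)
open import Relation.Binary.PropositionalEquality using (_≡_)
open import Relation.Nullary using (does)

∑ : ∀ {m} → (Fin m → ℤ) → ℤ
∑ {m} f = sum-syntax +-*-semiring m f

-- The simplices are subsets of an ambient vertex set Fin n; not every element
-- of Fin n has to be a vertex of the complex.  The finite set of simplices is
-- enumerated without repetition, and may be empty.
record SimplicialComplex (n : ℕ) : Set where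
  field
    simplices : List (Subset n)
    unique    : Unique simplices
    nonempty  : All Nonempty simplices
    closed    : ∀ {x y} → x ∈ simplices → Nonempty y → y ⊆ x → y ∈ simplices

  size : ℕ
  size = length simplices

  simplex : Fin size → Subset n
  simplex = lookup simplices

open SimplicialComplex public using (size; simplex)

-- Truncated subtraction is exact here, as simplices are non-empty.
dim : ∀ {n} → Subset n → ℕ
dim x = ∣ x ∣ ∸ 1

ω : ∀ {n} → Subset n → ℤ
ω x = -1ℤ ^ dim x

χ : ∀ {n} → SimplicialComplex n → ℤ
χ G = ∑ λ i → ω (simplex G i)

Matrix : ℕ → Set
Matrix m = Fin m → Fin m → ℤ

identity : ∀ {m} → Matrix m
identity i j = if does (i ≟ j) then 1ℤ else 0ℤ

_⊗_ : ∀ {m} → Matrix m → Matrix m → Matrix m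
(A ⊗ B) i k = ∑ λ j → A i j * B j k

IsInverse : ∀ {m} → Matrix m → Matrix m → Set
IsInverse A B = (∀ i j → (A ⊗ B) i j ≡ identity i j) × (∀ i j → (B ⊗ A) i j ≡ identity i j)

-- Rows and columns are indexed by positions in the enumeration of simplices.
connectionMatrix : ∀ {n} (G : SimplicialComplex n) → Matrix (size G)
connectionMatrix G i j =
  if does (nonempty? (simplex G i ∩ simplex G j)) then 1ℤ else 0ℤ

{-# OPTIONS --safe #-}
-- Let D = diag ω and let Z be the zeta matrix of inclusion, Z x y = [x ⊆ y].
-- The alternating sum of a Boolean interval vanishes unless the interval is a
-- point; hence D Z is an involution, and L = Zᵀ D Z because the nonempty faces
-- of x ∩ y have Euler characteristic 1 or 0.  So L⁻¹ = D Z D Zᵀ D, and since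
-- the column sums of D Z are Euler characteristics of full simplices, which
-- are 1, the entries of L⁻¹ sum to the trace of D.
module Submission where

open import Defs
open import Data.Nat using (ℕ; zero; suc)
open import Data.Product using (_×_; ∃; _,_; proj₂)
open import Relation.Binary.PropositionalEquality using (_≡_; _≢_; refl; sym; trans; cong; cong₂; module ≡-Reasoning)
open import Algebra.Properties.Semiring.Sum using (sum-cong-≗; ∑-comm; *-distribˡ-sum; *-distribʳ-sum)
open import Data.Bool using (Bool; true; false; if_then_else_; _∧_)
import Data.Bool.Properties as Bool
open import Data.Fin using (Fin; zero; suc; _≟_)
open import Data.Fin.Subset using (Subset; Nonempty; _⊆_; _∩_; ∣_∣; inside; outside; ⊥)
open import Data.Fin.Subset.Properties using (nonempty?; _⊆?_; Empty-unique; ⊥⊆; ∉⊥; ∣⊥∣≡0; p∩q⊆p; p∩q⊆q; x∈p∩q⁺; ⊆-refl; ⊆-trans)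
open import Data.Integer using (ℤ; 0ℤ; 1ℤ; -1ℤ; _+_; _*_; _-_; -_; _^_)
open import Data.Integer.Properties as ℤ using (+-*-semiring)
open import Data.Integer.Tactic.RingSolver using (solve-∀)
open import Data.List using (List; []; _∷_; lookup)
open import Data.List.Membership.Propositional using (_∈_; _∉_)
open import Data.List.Membership.Propositional.Properties using (∈-lookup)
open import Data.List.Relation.Unary.All as All using (All)
open import Data.List.Relation.Unary.AllPairs using (_∷_)
open import Data.List.Relation.Unary.Any using (here; there)
open import Data.List.Relation.Unary.Unique.Propositional using (Unique)
open import Data.Vec using ([]; _∷_; there)
open import Data.Vec.Properties using (≡-dec)
open import Function using (_∘_; _⇔_; mk⇔)
open import Relation.Binary.Definitions using (DecidableEquality)
open import Relation.Nullary using (¬_; Dec; yes; no; does; contradiction)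
open import Relation.Nullary.Decidable using (dec-true; dec-false; does-⇔; _×-dec_)

open SimplicialComplex using (simplices; unique; nonempty; closed)
open ≡-Reasoning

-- Integer indicators

ι : Bool → ℤ
ι b = if b then 1ℤ else 0ℤ

ι-∧ : ∀ a b → ι (a ∧ b) ≡ ι a * ι b
ι-∧ true  b = sym (ℤ.*-identityˡ (ι b))
ι-∧ false b = refl

ι-yes : ∀ {P : Set} (d : Dec P) → P → ι (does d) ≡ 1ℤ
ι-yes d p = cong ι (dec-true d p)

ι-no : ∀ {P : Set} (d : Dec P) → ¬ P → ι (does d) ≡ 0ℤ
ι-no d ¬p = cong ι (dec-false d ¬p)

infix 4 _≟ₛ_
_≟ₛ_ : ∀ {n} → DecidableEquality (Subset n)
_≟ₛ_ = ≡-dec Bool._≟_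

-- Sums over the power set of Fin n

∑ₛ : ∀ {n} → (Subset n → ℤ) → ℤ
∑ₛ {zero}  f = f []
∑ₛ {suc n} f = ∑ₛ (λ p → f (inside ∷ p)) + ∑ₛ (λ p → f (outside ∷ p))

∑ₛ-cong : ∀ {n} {f g : Subset n → ℤ} → (∀ p → f p ≡ g p) → ∑ₛ f ≡ ∑ₛ g
∑ₛ-cong {zero}  f≗g = f≗g []
∑ₛ-cong {suc n} f≗g = cong₂ _+_ (∑ₛ-cong (f≗g ∘ (inside ∷_))) (∑ₛ-cong (f≗g ∘ (outside ∷_)))

∑ₛ-zero : ∀ {n} {f : Subset n → ℤ} → (∀ p → f p ≡ 0ℤ) → ∑ₛ f ≡ 0ℤ
∑ₛ-zero {zero}  f≗0 = f≗0 []
∑ₛ-zero {suc n} f≗0 = cong₂ _+_ (∑ₛ-zero (f≗0 ∘ (inside ∷_))) (∑ₛ-zero (f≗0 ∘ (outside ∷_)))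

∑ₛ-distribˡ-* : ∀ {n} c (f : Subset n → ℤ) → ∑ₛ (λ p → c * f p) ≡ c * ∑ₛ f
∑ₛ-distribˡ-* {zero}  c f = refl
∑ₛ-distribˡ-* {suc n} c f =
  trans (cong₂ _+_ (∑ₛ-distribˡ-* c (f ∘ (inside ∷_))) (∑ₛ-distribˡ-* c (f ∘ (outside ∷_))))
        (sym (ℤ.*-distribˡ-+ c _ _))

-- If `f` vanishes off `x ∷ xs`, then `erase x f` vanishes off `xs`; this is what lets the induction
-- on the list in `∑-lookup` proceed.
erase : ∀ {n} → Subset n → (Subset n → ℤ) → Subset n → ℤ
erase x f p = if does (p ≟ₛ x) then 0ℤ else f p

erase-≢ : ∀ {n} (x : Subset n) f {p} → p ≢ x → erase x f p ≡ f p
erase-≢ x f {p} p≢x = cong (if_then 0ℤ else f p) (dec-false (p ≟ₛ x) p≢x)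

∑ₛ-erase : ∀ {n} (x : Subset n) f → ∑ₛ f ≡ f x + ∑ₛ (erase x f)
∑ₛ-erase []            f = sym (ℤ.+-identityʳ (f []))
∑ₛ-erase (inside  ∷ x) f =
  trans (cong (_+ ∑ₛ (f ∘ (outside ∷_))) (∑ₛ-erase x (f ∘ (inside ∷_))))
        (ℤ.+-assoc (f (inside ∷ x)) _ _)
∑ₛ-erase (outside ∷ x) f =
  trans (cong (∑ₛ (f ∘ (inside ∷_)) +_) (∑ₛ-erase x (f ∘ (outside ∷_))))
        (rearrange (∑ₛ (f ∘ (inside ∷_))) (f (outside ∷ x)) _)
  where
  rearrange : ∀ a b c → a + (b + c) ≡ b + (a + c)
  rearrange = solve-∀

-- Uniqueness prevents double counting and the support condition prevents omissions, so index sums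
-- can be computed coordinatewise on the whole power set.
∑-lookup : ∀ {n} (xs : List (Subset n)) → Unique xs → (f : Subset n → ℤ) →
  (∀ p → p ∉ xs → f p ≡ 0ℤ) → ∑ (f ∘ lookup xs) ≡ ∑ₛ f
∑-lookup []       _            f f≡0 = sym (∑ₛ-zero (λ p → f≡0 p (λ ())))
∑-lookup (x ∷ xs) (x≢xs ∷ uxs) f f≡0 = begin
  -- By uniqueness `x` does not recur in the tail, so erasing it changes no summand there.
  f x + ∑ (f ∘ lookup xs)          ≡⟨ cong (f x +_) (sum-cong-≗ +-*-semiring (λ i → sym (erase-≢ x f (λ eq → All.lookup x≢xs (∈-lookup i) (sym eq))))) ⟩
  f x + ∑ (erase x f ∘ lookup xs)  ≡⟨ cong (f x +_) (∑-lookup xs uxs (erase x f) erase≡0) ⟩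
  f x + ∑ₛ (erase x f)             ≡⟨ sym (∑ₛ-erase x f) ⟩
  ∑ₛ f                             ∎
  where
  erase≡0 : ∀ p → p ∉ xs → erase x f p ≡ 0ℤ
  erase≡0 p p∉xs with p ≟ₛ x
  ... | yes p≡x = refl
  ... | no  p≢x = f≡0 p λ { (here p≡x) → p≢x p≡x ; (there p∈xs) → p∉xs p∈xs }

lookup-injective : ∀ {A : Set} {xs : List A} → Unique xs → ∀ {i j} → lookup xs i ≡ lookup xs j → i ≡ j
lookup-injective (_    ∷ _)   {zero}  {zero}  _  = refl
lookup-injective (x≢xs ∷ _)   {zero}  {suc j} eq = contradiction eq (All.lookup x≢xs (∈-lookup j))
lookup-injective (x≢xs ∷ _)   {suc i} {zero}  eq = contradiction (sym eq) (All.lookup x≢xs (∈-lookup i))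
lookup-injective (_    ∷ uxs) {suc i} {suc j} eq = cong suc (lookup-injective uxs eq)

-- The Möbius function of the Boolean lattice

-- Unlike ω, the parity sign is multiplicative also at the empty set.
ε : ∀ {n} → Subset n → ℤ
ε p = -1ℤ ^ ∣ p ∣

-- For a nonempty set the dimension is exactly one less than the cardinality, which costs one sign.
ω≡-ε : ∀ {n} (p : Subset n) → Nonempty p → ω p ≡ - ε p
ω≡-ε (inside  ∷ p) _                   = sym (neg-neg (ε p))
  where
  neg-neg : ∀ a → - (-1ℤ * a) ≡ a
  neg-neg = solve-∀
ω≡-ε (outside ∷ p) (suc i , there i∈p) = ω≡-ε p (i , i∈p)

-- The product form makes this `zeta i k * zeta k j` by definition when all three sets are
-- simplices.
interval : ∀ {n} → Subset n → Subset n → Subset n → ℤ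
interval x z p = ι (does (x ⊆? p)) * ι (does (p ⊆? z))

∑ₛ-interval-inside : ∀ {n} (x z : Subset n) →
  ∑ₛ (λ p → interval x z p * (-1ℤ * ε p)) ≡ -1ℤ * ∑ₛ (λ p → interval x z p * ε p)
∑ₛ-interval-inside x z =
  trans (∑ₛ-cong (λ p → *-swap (interval x z p) -1ℤ (ε p)))
        (∑ₛ-distribˡ-* -1ℤ (λ p → interval x z p * ε p))
  where
  *-swap : ∀ a b c → a * (b * c) ≡ b * (a * c)
  *-swap = solve-∀

-- Induction over the vertices. A vertex of `z` outside `x` may be taken or left, and the two
-- choices cancel; a vertex of `x` outside `z` empties the interval; at any other vertex the choice
-- is forced.
∑ₛ-interval : ∀ {n} (x z : Subset n) → ∑ₛ (λ p → interval x z p * ε p) ≡ ι (does (x ≟ₛ z)) * ε z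
∑ₛ-interval []            []            = refl
∑ₛ-interval {suc n} (inside ∷ x) (inside ∷ z) = begin
  -- The half over `outside ∷ p` is already zero by computation, as such a set cannot contain
  -- `inside ∷ x`.
  ∑ₛ (λ p → interval x z p * (-1ℤ * ε p)) + ∑ₛ {n} (λ _ → 0ℤ)
    ≡⟨ cong₂ _+_ (∑ₛ-interval-inside x z) (∑ₛ-zero {n} (λ _ → refl)) ⟩
  -1ℤ * ∑ₛ (λ p → interval x z p * ε p) + 0ℤ
    ≡⟨ cong (λ s → -1ℤ * s + 0ℤ) (∑ₛ-interval x z) ⟩
  -1ℤ * (ι (does (x ≟ₛ z)) * ε z) + 0ℤ
    ≡⟨ rearrange (ι (does (x ≟ₛ z))) (ε z) ⟩
  ι (does (x ≟ₛ z)) * (-1ℤ * ε z) ∎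
  where
  rearrange : ∀ a b → -1ℤ * (a * b) + 0ℤ ≡ a * (-1ℤ * b)
  rearrange = solve-∀
∑ₛ-interval {suc n} (inside ∷ x) (outside ∷ z) =
  cong₂ _+_ (∑ₛ-zero (λ p → cong (_* ε (inside ∷ p)) (ℤ.*-zeroʳ (ι (does (x ⊆? p)))))) (∑ₛ-zero {n} (λ _ → refl))
∑ₛ-interval (outside ∷ x) (inside ∷ z)  =
  trans (cong (_+ ∑ₛ (λ p → interval x z p * ε p)) (∑ₛ-interval-inside x z))
        (cancel (∑ₛ (λ p → interval x z p * ε p)))
  where
  cancel : ∀ a → -1ℤ * a + a ≡ 0ℤ
  cancel = solve-∀
∑ₛ-interval (outside ∷ x) (outside ∷ z) =
  trans (cong₂ _+_ (∑ₛ-zero (λ p → cong (_* ε (inside ∷ p)) (ℤ.*-zeroʳ (ι (does (x ⊆? p)))))) (∑ₛ-interval x z))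
        (ℤ.+-identityˡ _)

⊆×⊆⇔⊆∩ : ∀ {n} (p q r : Subset n) → (p ⊆ q × p ⊆ r) ⇔ p ⊆ q ∩ r
⊆×⊆⇔⊆∩ p q r = mk⇔ to from
  where
  to : p ⊆ q × p ⊆ r → p ⊆ q ∩ r
  to (p⊆q , p⊆r) v∈p = x∈p∩q⁺ (p⊆q v∈p , p⊆r v∈p)

  from : p ⊆ q ∩ r → p ⊆ q × p ⊆ r
  from p⊆q∩r = (λ v∈p → p∩q⊆p q r (p⊆q∩r v∈p)) , (λ v∈p → p∩q⊆q q r (p⊆q∩r v∈p))

-- Matrices over the integers

∑-cong : ∀ {m} {f g : Fin m → ℤ} → (∀ i → f i ≡ g i) → ∑ f ≡ ∑ g
∑-cong = sum-cong-≗ +-*-semiring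

∑-distribˡ-* : ∀ {m} c (f : Fin m → ℤ) → c * ∑ f ≡ ∑ (λ i → c * f i)
∑-distribˡ-* = *-distribˡ-sum +-*-semiring

∑-distribʳ-* : ∀ {m} c (f : Fin m → ℤ) → ∑ f * c ≡ ∑ (λ i → f i * c)
∑-distribʳ-* = *-distribʳ-sum +-*-semiring

∑-swap : ∀ {m} (f : Fin m → Fin m → ℤ) → ∑ (λ i → ∑ (λ j → f i j)) ≡ ∑ (λ j → ∑ (λ i → f i j))
∑-swap = ∑-comm +-*-semiring

infix 4 _≐_
_≐_ : ∀ {m} → Matrix m → Matrix m → Set
A ≐ B = ∀ i j → A i j ≡ B i j

⊗-cong : ∀ {m} {A A′ B B′ : Matrix m} → A ≐ A′ → B ≐ B′ → (A ⊗ B) ≐ (A′ ⊗ B′)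
⊗-cong A≐A′ B≐B′ i k = ∑-cong (λ j → cong₂ _*_ (A≐A′ i j) (B≐B′ j k))

⊗-assoc : ∀ {m} (A B C : Matrix m) → ((A ⊗ B) ⊗ C) ≐ (A ⊗ (B ⊗ C))
⊗-assoc A B C i l = begin
  ∑ (λ k → ∑ (λ j → A i j * B j k) * C k l)    ≡⟨ ∑-cong (λ k → ∑-distribʳ-* (C k l) (λ j → A i j * B j k)) ⟩
  ∑ (λ k → ∑ (λ j → A i j * B j k * C k l))    ≡⟨ ∑-swap (λ k j → A i j * B j k * C k l) ⟩
  ∑ (λ j → ∑ (λ k → A i j * B j k * C k l))    ≡⟨ ∑-cong (λ j → ∑-cong (λ k → ℤ.*-assoc (A i j) (B j k) (C k l))) ⟩
  ∑ (λ j → ∑ (λ k → A i j * (B j k * C k l)))  ≡⟨ ∑-cong (λ j → sym (∑-distribˡ-* (A i j) (λ k → B j k * C k l))) ⟩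
  ∑ (λ j → A i j * ∑ (λ k → B j k * C k l))    ∎

identity-suc : ∀ {m} (i j : Fin m) → identity (suc i) (suc j) ≡ identity i j
identity-suc i j with i ≟ j
... | yes _ = refl
... | no  _ = refl

identity-sym : ∀ {m} (i j : Fin m) → identity i j ≡ identity j i
identity-sym i j = cong ι (does-⇔ (mk⇔ sym sym) (i ≟ j) (j ≟ i))

∑-identityˡ : ∀ {m} (f : Fin m → ℤ) i → ∑ (λ j → identity i j * f j) ≡ f i
∑-identityˡ {suc m} f zero    = begin
  1ℤ * f zero + ∑ {m} (λ j → 0ℤ)  ≡⟨ cong (1ℤ * f zero +_) (sym (∑-distribˡ-* {m} 0ℤ (λ _ → 0ℤ))) ⟩
  1ℤ * f zero + 0ℤ                ≡⟨ ℤ.+-identityʳ _ ⟩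
  1ℤ * f zero                     ≡⟨ ℤ.*-identityˡ _ ⟩
  f zero                          ∎
∑-identityˡ {suc m} f (suc i) = begin
  0ℤ + ∑ (λ j → identity (suc i) (suc j) * f (suc j))  ≡⟨ ℤ.+-identityˡ _ ⟩
  ∑ (λ j → identity (suc i) (suc j) * f (suc j))       ≡⟨ ∑-cong (λ j → cong (_* f (suc j)) (identity-suc i j)) ⟩
  ∑ (λ j → identity i j * f (suc j))                   ≡⟨ ∑-identityˡ (f ∘ suc) i ⟩
  f (suc i)                                            ∎

⊗-identityˡ : ∀ {m} (A : Matrix m) → (identity ⊗ A) ≐ A
⊗-identityˡ A i k = ∑-identityˡ (λ j → A j k) i

⊗-identityʳ : ∀ {m} (A : Matrix m) → (A ⊗ identity) ≐ A
⊗-identityʳ A i k =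
  trans (∑-cong (λ j → trans (ℤ.*-comm (A i j) _) (cong (_* A i j) (identity-sym j k))))
        (∑-identityˡ (A i) k)

-- Once `L` is factored, both products of `L` with `green` have this shape, with an inverse pair in
-- the middle.
⊗-cancel-inner : ∀ {m} (A B C D : Matrix m) → (B ⊗ C) ≐ identity → ((A ⊗ B) ⊗ (C ⊗ D)) ≐ (A ⊗ D)
⊗-cancel-inner A B C D BC≐I i j = begin
  ((A ⊗ B) ⊗ (C ⊗ D)) i j  ≡⟨ ⊗-assoc A B (C ⊗ D) i j ⟩
  (A ⊗ (B ⊗ (C ⊗ D))) i j  ≡⟨ ⊗-cong {A = A} (λ _ _ → refl) (λ k l → sym (⊗-assoc B C D k l)) i j ⟩
  (A ⊗ ((B ⊗ C) ⊗ D)) i j  ≡⟨ ⊗-cong {A = A} (λ _ _ → refl) (⊗-cong {B = D} BC≐I (λ _ _ → refl)) i j ⟩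
  (A ⊗ (identity ⊗ D)) i j ≡⟨ ⊗-cong {A = A} (λ _ _ → refl) (⊗-identityˡ D) i j ⟩
  (A ⊗ D) i j              ∎

-- The usual computation g = g (A h) = (g A) h = h; it carries the entry sum of one explicit inverse
-- over to any other.
inverse-unique : ∀ {m} (A g h : Matrix m) → IsInverse A g → IsInverse A h → g ≐ h
inverse-unique A g h (_ , gA≐I) (Ah≐I , _) i j = begin
  g i j                  ≡⟨ sym (⊗-identityʳ g i j) ⟩
  (g ⊗ identity) i j     ≡⟨ ⊗-cong {A = g} (λ _ _ → refl) (λ k l → sym (Ah≐I k l)) i j ⟩
  (g ⊗ (A ⊗ h)) i j      ≡⟨ sym (⊗-assoc g A h i j) ⟩
  ((g ⊗ A) ⊗ h) i j      ≡⟨ ⊗-cong {B = h} gA≐I (λ _ _ → refl) i j ⟩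
  (identity ⊗ h) i j     ≡⟨ ⊗-identityˡ h i j ⟩
  h i j                  ∎

-- Alternating sums over the faces of a complex

module _ {n} (G : SimplicialComplex n) where

  private
    s = simplex G

    simplex∈ : ∀ i → s i ∈ simplices G
    simplex∈ i = ∈-lookup i

    simplex-nonempty : ∀ i → Nonempty (s i)
    simplex-nonempty i = All.lookup (nonempty G) (simplex∈ i)

    L = connectionMatrix G

  -- ⊥ is not a simplex, so it is added to the enumeration to reach all faces of u.
  ∑-interval : ∀ x {u} k → u ⊆ s k →
    ∑ (λ i → interval x u (s i) * ω (s i)) ≡ ι (does (x ⊆? ⊥)) - ι (does (x ≟ₛ u)) * ε u
  ∑-interval x {u} k u⊆sk = begin
    ∑ (λ i → interval x u (s i) * ω (s i))
      ≡⟨ ∑-cong (λ i → trans (cong (interval x u (s i) *_) (ω≡-ε (s i) (simplex-nonempty i))) (neg-out (interval x u (s i)) (ε (s i)))) ⟩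
    ∑ (λ i → -1ℤ * F (s i))                   ≡⟨ sym (∑-distribˡ-* -1ℤ (F ∘ s)) ⟩
    -1ℤ * ∑ (F ∘ s)                           ≡⟨ add-sub (F ⊥) (∑ (F ∘ s)) ⟩
    F ⊥ - (F ⊥ + ∑ (F ∘ s))                   ≡⟨ cong₂ _-_ F⊥ (trans (∑-lookup (⊥ ∷ simplices G) (⊥≢ ∷ unique G) F F≡0) (∑ₛ-interval x u)) ⟩
    ι (does (x ⊆? ⊥)) - ι (does (x ≟ₛ u)) * ε u ∎
    where
    F : Subset n → ℤ
    F p = interval x u p * ε p

    neg-out : ∀ a b → a * - b ≡ -1ℤ * (a * b)
    neg-out = solve-∀

    add-sub : ∀ a b → -1ℤ * b ≡ a - (a + b)
    add-sub = solve-∀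

    F⊥ : F ⊥ ≡ ι (does (x ⊆? ⊥))
    F⊥ = begin
      ι (does (x ⊆? ⊥)) * ι (does (⊥ ⊆? u)) * -1ℤ ^ ∣ ⊥ {n} ∣
        ≡⟨ cong₂ (λ a b → ι (does (x ⊆? ⊥)) * a * -1ℤ ^ b) (ι-yes (⊥ ⊆? u) ⊥⊆) (∣⊥∣≡0 n) ⟩
      ι (does (x ⊆? ⊥)) * 1ℤ * 1ℤ  ≡⟨ trans (ℤ.*-identityʳ _) (ℤ.*-identityʳ _) ⟩
      ι (does (x ⊆? ⊥))            ∎

    ⊥≢ : All (⊥ ≢_) (simplices G)
    ⊥≢ = All.map (λ { (_ , v∈p) refl → ∉⊥ v∈p }) (nonempty G)

    -- Closure under faces enters here: a nonempty subset of `u` lies in `s k`, hence is a simplex,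
    -- so nothing in the interval is missing from the enumeration.
    F≡0 : ∀ p → p ∉ ⊥ ∷ simplices G → F p ≡ 0ℤ
    F≡0 p p∉ = cong (_* ε p) (trans (cong (ι (does (x ⊆? p)) *_) (ι-no (p ⊆? u) p⊈u)) (ℤ.*-zeroʳ (ι (does (x ⊆? p)))))
      where
      p⊈u : ¬ p ⊆ u
      p⊈u p⊆u with nonempty? p
      ... | yes ne = p∉ (there (closed G (simplex∈ k) ne (⊆-trans p⊆u u⊆sk)))
      ... | no  ¬ne = p∉ (here (Empty-unique ¬ne))

  -- The case `x = ⊥` of `∑-interval`: its value is 1 - 0 for nonempty `u` and 1 - 1 for empty `u`.
  ∑-faces : ∀ {u} k → u ⊆ s k →
    ∑ (λ i → ω (s i) * ι (does (s i ⊆? u))) ≡ ι (does (nonempty? u))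
  ∑-faces {u} k u⊆sk = begin
    ∑ (λ i → ω (s i) * ι (does (s i ⊆? u)))
      ≡⟨ ∑-cong (λ i → trans (insert-1 (ω (s i)) _) (cong (λ a → a * ι (does (s i ⊆? u)) * ω (s i)) (sym (ι-yes (⊥ ⊆? s i) ⊥⊆)))) ⟩
    ∑ (λ i → interval ⊥ u (s i) * ω (s i))           ≡⟨ ∑-interval ⊥ k u⊆sk ⟩
    ι (does (⊥ ⊆? ⊥ {n})) - ι (does (⊥ ≟ₛ u)) * ε u  ≡⟨ cong (_- ι (does (⊥ ≟ₛ u)) * ε u) (ι-yes (⊥ ⊆? ⊥ {n}) ⊥⊆) ⟩
    1ℤ - ι (does (⊥ ≟ₛ u)) * ε u                     ≡⟨ by-emptiness (nonempty? u) ⟩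
    ι (does (nonempty? u))                           ∎
    where
    insert-1 : ∀ a b → a * b ≡ 1ℤ * b * a
    insert-1 = solve-∀

    by-emptiness : (d : Dec (Nonempty u)) → 1ℤ - ι (does (⊥ ≟ₛ u)) * ε u ≡ ι (does d)
    by-emptiness (yes (_ , v∈u)) = cong (λ a → 1ℤ - a * ε u) (ι-no (⊥ ≟ₛ u) λ { refl → ∉⊥ v∈u })
    by-emptiness (no ¬ne) with Empty-unique ¬ne
    ... | refl = cong₂ (λ a b → 1ℤ - a * -1ℤ ^ b) (ι-yes (⊥ ≟ₛ u) refl) (∣⊥∣≡0 n)

  -- The zeta matrix, its inverse and the factorisation of the connection matrix

  zeta : Matrix (size G)
  zeta i j = ι (does (s i ⊆? s j))

  signedZeta : Matrix (size G)
  signedZeta i j = ω (s i) * zeta i j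

  -- The transpose of D Z D.
  moebiusᵀ : Matrix (size G)
  moebiusᵀ i j = ω (s i) * signedZeta j i

  -- The inverses of the two factors of `L` in reverse order: `signedZeta` inverts itself and
  -- `moebiusᵀ` inverts `zetaᵀ`.
  green : Matrix (size G)
  green = signedZeta ⊗ moebiusᵀ

  ω²≡1 : ∀ (p : Subset n) → ω p * ω p ≡ 1ℤ
  ω²≡1 p = square (dim p)
    where
    regroup : ∀ a → -1ℤ * a * (-1ℤ * a) ≡ a * a
    regroup = solve-∀

    square : ∀ k → -1ℤ ^ k * -1ℤ ^ k ≡ 1ℤ
    square zero    = refl
    square (suc k) = trans (regroup (-1ℤ ^ k)) (square k)

  -- In matrix form, Z D Z = D. Intervals between simplices are Boolean; the correction term at `⊥`
  -- drops out because `s i` is nonempty, and uniqueness turns equality of simplices into equality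
  -- of indices.
  ∑-simplex-interval : ∀ i j → ∑ (λ k → zeta i k * zeta k j * ω (s k)) ≡ identity i j * ω (s j)
  ∑-simplex-interval i j = begin
    ∑ (λ k → zeta i k * zeta k j * ω (s k))                    ≡⟨ ∑-interval (s i) j ⊆-refl ⟩
    ι (does (s i ⊆? ⊥)) - ι (does (s i ≟ₛ s j)) * ε (s j)      ≡⟨ cong₂ (λ a b → a - b * ε (s j)) (ι-no (s i ⊆? ⊥) si⊈⊥) (cong ι (does-⇔ (mk⇔ (lookup-injective (unique G)) (cong s)) (s i ≟ₛ s j) (i ≟ j))) ⟩
    0ℤ - identity i j * ε (s j)                                ≡⟨ neg-in (identity i j) (ε (s j)) ⟩
    identity i j * - ε (s j)                                   ≡⟨ cong (identity i j *_) (sym (ω≡-ε (s j) (simplex-nonempty j))) ⟩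
    identity i j * ω (s j)                                     ∎
    where
    si⊈⊥ : ¬ s i ⊆ ⊥
    si⊈⊥ si⊆⊥ = ∉⊥ (si⊆⊥ (proj₂ (simplex-nonempty i)))

    neg-in : ∀ a b → 0ℤ - a * b ≡ a * - b
    neg-in = solve-∀

  identity-ω : ∀ i j → ω (s i) * (identity i j * ω (s j)) ≡ identity i j
  identity-ω i j with i ≟ j
  ... | yes refl = trans (cong (ω (s i) *_) (ℤ.*-identityˡ (ω (s i)))) (ω²≡1 (s i))
  ... | no _     = ℤ.*-zeroʳ (ω (s i))

  -- Multiplying Z D Z = D by D on the left gives D D, which is the identity since signs square to
  -- 1.
  signedZeta-involutive : (signedZeta ⊗ signedZeta) ≐ identity
  signedZeta-involutive i j = begin
    ∑ (λ k → ω (s i) * zeta i k * (ω (s k) * zeta k j))  ≡⟨ ∑-cong (λ k → regroup (ω (s i)) (zeta i k) (ω (s k)) (zeta k j)) ⟩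
    ∑ (λ k → ω (s i) * (zeta i k * zeta k j * ω (s k)))  ≡⟨ sym (∑-distribˡ-* (ω (s i)) (λ k → zeta i k * zeta k j * ω (s k))) ⟩
    ω (s i) * ∑ (λ k → zeta i k * zeta k j * ω (s k))    ≡⟨ cong (ω (s i) *_) (∑-simplex-interval i j) ⟩
    ω (s i) * (identity i j * ω (s j))                   ≡⟨ identity-ω i j ⟩
    identity i j                                         ∎
    where
    regroup : ∀ a b c d → a * b * (c * d) ≡ a * (b * d * c)
    regroup = solve-∀

  zetaᵀ : Matrix (size G)
  zetaᵀ i j = zeta j i

  -- The product Zᵀ D Zᵀ D is the transpose of D Z D Z.
  zetaᵀ⊗moebiusᵀ : (zetaᵀ ⊗ moebiusᵀ) ≐ identity
  zetaᵀ⊗moebiusᵀ i j = begin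
    ∑ (λ k → zeta k i * (ω (s k) * signedZeta j k))  ≡⟨ ∑-cong (λ k → regroup (zeta k i) (ω (s k)) (signedZeta j k)) ⟩
    (signedZeta ⊗ signedZeta) j i                    ≡⟨ signedZeta-involutive j i ⟩
    identity j i                                     ≡⟨ identity-sym j i ⟩
    identity i j                                     ∎
    where
    regroup : ∀ a b c → a * (b * c) ≡ c * (b * a)
    regroup = solve-∀

  -- Here D Zᵀ D Zᵀ = D (Z D Z)ᵀ = D D.
  moebiusᵀ⊗zetaᵀ : (moebiusᵀ ⊗ zetaᵀ) ≐ identity
  moebiusᵀ⊗zetaᵀ i j = begin
    ∑ (λ k → ω (s i) * (ω (s k) * zeta k i) * zeta j k)  ≡⟨ ∑-cong (λ k → regroup (ω (s i)) (ω (s k)) (zeta k i) (zeta j k)) ⟩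
    ∑ (λ k → ω (s i) * (zeta j k * zeta k i * ω (s k)))  ≡⟨ sym (∑-distribˡ-* (ω (s i)) (λ k → zeta j k * zeta k i * ω (s k))) ⟩
    ω (s i) * ∑ (λ k → zeta j k * zeta k i * ω (s k))    ≡⟨ cong (ω (s i) *_) (∑-simplex-interval j i) ⟩
    ω (s i) * (identity j i * ω (s i))                   ≡⟨ factor (ω (s i)) (identity j i) ⟩
    ω (s i) * ω (s i) * identity j i                     ≡⟨ cong₂ _*_ (ω²≡1 (s i)) (identity-sym j i) ⟩
    1ℤ * identity i j                                    ≡⟨ ℤ.*-identityˡ (identity i j) ⟩
    identity i j                                         ∎
    where
    regroup : ∀ a b c d → a * (b * c) * d ≡ a * (d * c * b)
    regroup = solve-∀

    factor : ∀ a b → a * (b * a) ≡ a * a * b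
    factor = solve-∀

  connection-factors : L ≐ (zetaᵀ ⊗ signedZeta)
  connection-factors i j = sym (begin
    ∑ (λ k → zeta k i * (ω (s k) * zeta k j))           ≡⟨ ∑-cong (λ k → regroup (zeta k i) (ω (s k)) (zeta k j)) ⟩
    ∑ (λ k → ω (s k) * (zeta k i * zeta k j))           ≡⟨ ∑-cong (λ k → cong (ω (s k) *_) (⊆-∩ k)) ⟩
    -- The common faces of `s i` and `s j` are the faces of their intersection, which lies in the
    -- simplex `s i` as `∑-faces` requires.
    ∑ (λ k → ω (s k) * ι (does (s k ⊆? (s i ∩ s j))))   ≡⟨ ∑-faces i (p∩q⊆p (s i) (s j)) ⟩
    L i j                                               ∎)
    where
    regroup : ∀ a b c → a * (b * c) ≡ b * (a * c)
    regroup = solve-∀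

    ⊆-∩ : ∀ k → zeta k i * zeta k j ≡ ι (does (s k ⊆? (s i ∩ s j)))
    ⊆-∩ k = trans (sym (ι-∧ (does (s k ⊆? s i)) _)) (cong ι (does-⇔ (⊆×⊆⇔⊆∩ (s k) (s i) (s j))
      ((s k ⊆? s i) ×-dec (s k ⊆? s j)) (s k ⊆? (s i ∩ s j))))

  -- The inverse of the connection matrix and the sum of its entries

  green-inverse : IsInverse L green
  green-inverse = L⊗green , green⊗L
    where
    L⊗green : (L ⊗ green) ≐ identity
    L⊗green i j = begin
      (L ⊗ green) i j                       ≡⟨ ⊗-cong {B = green} connection-factors (λ _ _ → refl) i j ⟩
      ((zetaᵀ ⊗ signedZeta) ⊗ green) i j    ≡⟨ ⊗-cancel-inner zetaᵀ signedZeta signedZeta moebiusᵀ signedZeta-involutive i j ⟩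
      (zetaᵀ ⊗ moebiusᵀ) i j                ≡⟨ zetaᵀ⊗moebiusᵀ i j ⟩
      identity i j                          ∎

    green⊗L : (green ⊗ L) ≐ identity
    green⊗L i j = begin
      (green ⊗ L) i j                       ≡⟨ ⊗-cong {A = green} (λ _ _ → refl) connection-factors i j ⟩
      (green ⊗ (zetaᵀ ⊗ signedZeta)) i j    ≡⟨ ⊗-cancel-inner signedZeta moebiusᵀ zetaᵀ signedZeta moebiusᵀ⊗zetaᵀ i j ⟩
      (signedZeta ⊗ signedZeta) i j         ≡⟨ signedZeta-involutive i j ⟩
      identity i j                          ∎

  signedZeta-column-sum : ∀ k → ∑ (λ i → signedZeta i k) ≡ 1ℤ
  signedZeta-column-sum k = trans (∑-faces k ⊆-refl) (ι-yes (nonempty? (s k)) (simplex-nonempty k))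

  ∑-green : ∑ (λ i → ∑ (λ j → green i j)) ≡ χ G
  ∑-green = begin
    ∑ (λ i → ∑ (λ j → ∑ (λ k → signedZeta i k * moebiusᵀ k j)))
      -- With the inner index `k` fixed, the double sum over `i` and `j` splits into a column sum of
      -- `signedZeta` times a row sum of `moebiusᵀ`, that is 1 times `ω (s k)`.
      ≡⟨ ∑-cong (λ i → ∑-swap (λ j k → signedZeta i k * moebiusᵀ k j)) ⟩
    ∑ (λ i → ∑ (λ k → ∑ (λ j → signedZeta i k * moebiusᵀ k j)))
      ≡⟨ ∑-cong (λ i → ∑-cong (λ k → trans (sym (∑-distribˡ-* (signedZeta i k) (moebiusᵀ k))) (cong (signedZeta i k *_) (moebiusᵀ-row-sum k)))) ⟩
    ∑ (λ i → ∑ (λ k → signedZeta i k * ω (s k)))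
      ≡⟨ ∑-swap (λ i k → signedZeta i k * ω (s k)) ⟩
    ∑ (λ k → ∑ (λ i → signedZeta i k * ω (s k)))
      ≡⟨ ∑-cong (λ k → trans (sym (∑-distribʳ-* (ω (s k)) (λ i → signedZeta i k))) (trans (cong (_* ω (s k)) (signedZeta-column-sum k)) (ℤ.*-identityˡ (ω (s k))))) ⟩
    χ G ∎
    where
    -- Row `k` of `moebiusᵀ` is column `k` of `signedZeta` scaled by `ω (s k)`.
    moebiusᵀ-row-sum : ∀ k → ∑ (moebiusᵀ k) ≡ ω (s k)
    moebiusᵀ-row-sum k =
      trans (sym (∑-distribˡ-* (ω (s k)) (λ j → signedZeta j k)))
            (trans (cong (ω (s k) *_) (signedZeta-column-sum k)) (ℤ.*-identityʳ (ω (s k))))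

theorem2 : ∀ {n : ℕ} (G : SimplicialComplex n) →
    ∃ (λ g → IsInverse (connectionMatrix G) g) ×
    (∀ (g : Matrix (size G)) → IsInverse (connectionMatrix G) g →
    ∑ (λ x → ∑ (λ y → g x y)) ≡ χ G)
theorem2 G = (green G , green-inverse G) , λ g g-inverse →
  trans (∑-cong (λ x → ∑-cong (λ y → inverse-unique (connectionMatrix G) g (green G) g-inverse (green-inverse G) x y)))
        (∑-green G)
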